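{- Let $F$ be a recurrent set and $d\ge1$ an integer. A bifix code $Y\subset F$ is the kernel of some bifix code $X\subset F$ of finite $F$-degree $d$ if and only if (i) $Y$ is not an $F$-maximal bifix code, and (ii) $\max\{\delta_Y(y)\mid y\in Y\}\le d-1$.
   Context: $A$ is a finite alphabet. $F\subset A^*$ is recurrent if it is nonempty, closed under factors, and for all $u,w\in F$ there is $v\in F$ with $uvw\in F$. A bifix code is a set of nonempty words none of which is a proper prefix or proper suffix of another; $Y\subset F$ is $F$-maximal bifix if not properly contained in a bifix code contained in $F$. For a set $Z$, a parse of $w$ with respect to $Z$ is a triple $(v,z,u)$ with $w=vzu$, $v$ having no suffix in $Z$, $z\in Z^*$, $u$ having no prefix in $Z$; $\delta_Z(w)$ is the number of parses and $d_F(Z)=\max_{w\in F}\delta_Z(w)$. The kernel of $X$ is $K(X)=\{x\in X\mid A^+xA^+\cap X\neq\emptyset\}$.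
   Formalization: The case F = {ε} with d = 1 is excluded, since there the claim fails: X = ∅ has F-degree 1 and kernel Y = ∅, yet Y = ∅ is F-maximal, so (i) does not hold. -}

module Defs where

open import Data.List.Base using (List; []; _++_; concat; length)
open import Data.List.Membership.Propositional using () renaming (_∈_ to _∈ˡ_)
open import Data.List.Relation.Unary.All using (All)
open import Data.List.Relation.Unary.Unique.Propositional using (Unique)
open import Data.Nat.Base using (ℕ; _≤_)
open import Data.Product.Base using (∃-syntax; _×_; _,_)
open import Function.Bundles using (_⇔_)
open import Level using (0ℓ)
open import Relation.Binary.PropositionalEquality.Core using (_≡_; _≢_)
open import Relation.Nullary.Negation.Core using (¬_)
open import Relation.Unary using (Pred; _∈_; _∉_; _⊆_; _⊂_)

Word : Set → Set
Word A = List A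

Language : Set → Set₁
Language A = Pred (Word A) 0ℓ

module _ {A : Set} where

  _IsPrefixOf_ _IsSuffixOf_ : Word A → Word A → Set
  p IsPrefixOf w = ∃[ s ] w ≡ p ++ s
  s IsSuffixOf w = ∃[ p ] w ≡ p ++ s

  _IsProperPrefixOf_ _IsProperSuffixOf_ : Word A → Word A → Set
  p IsProperPrefixOf w = p IsPrefixOf w × p ≢ w
  s IsProperSuffixOf w = s IsSuffixOf w × s ≢ w

  record Recurrent (F : Language A) : Set where
    field
      nonempty  : ∃[ w ] w ∈ F
      factorial : ∀ p u s → p ++ u ++ s ∈ F → u ∈ F
      recurrent : ∀ u w → u ∈ F → w ∈ F → ∃[ v ] (v ∈ F × u ++ v ++ w ∈ F)

  record BifixCode (X : Language A) : Set where
    field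
      []∉    : [] ∉ X
      prefix : ∀ x y → x ∈ X → y ∈ X → ¬ (x IsProperPrefixOf y)
      suffix : ∀ x y → x ∈ X → y ∈ X → ¬ (x IsProperSuffixOf y)

  record MaximalBifixCode (F Y : Language A) : Set₁ where
    field
      bifix   : BifixCode Y
      inside  : Y ⊆ F
      maximal : ¬ (∃[ Z ] (BifixCode Z × Z ⊆ F × Y ⊂ Z))

  _* : Language A → Language A
  (Z *) w = ∃[ zs ] (All Z zs × w ≡ concat zs)

  record IsParse (Z : Language A) (w : Word A) (v z u : Word A) : Set where
    field
      factorisation : w ≡ v ++ z ++ u
      left          : ∀ s → s IsSuffixOf v → s ∉ Z
      middle        : z ∈ Z *
      right         : ∀ p → p IsPrefixOf u → p ∉ Z

  -- δ_Z(w) = n.  A relation rather than a function because membership in Z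
  -- need not be decidable.  The parses counted are the triples of words
  -- themselves, so different proofs of IsParse are not counted separately.
  ParseCount : Language A → Word A → ℕ → Set
  ParseCount Z w n = ∃[ ts ] (Unique ts
                            × (∀ v z u → (v , z , u) ∈ˡ ts ⇔ IsParse Z w v z u)
                            × length ts ≡ n)

  -- δ_Z(w) ≤ n for every w in W, i.e. max { δ_Z(w) ∣ w ∈ W } ≤ n, the maximum
  -- over the empty set imposing no condition.
  ParsesBoundedOn : Language A → Language A → ℕ → Set
  ParsesBoundedOn W Z n = ∀ w → w ∈ W → ∃[ m ] (ParseCount Z w m × m ≤ n)

  -- d_F(Z) = d; in particular the maximum exists and is attained.
  HasDegree : Language A → Language A → ℕ → Set
  HasDegree F Z d = (∃[ w ] (w ∈ F × ParseCount Z w d)) × ParsesBoundedOn F Z d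

  Kernel : Language A → Language A
  Kernel X x = x ∈ X × ∃[ p ] ∃[ s ] (p ≢ [] × s ≢ [] × p ++ x ++ s ∈ X)

{-# OPTIONS --safe #-}

-- For a bifix code Z, δ_Z(w) counts the suffixes of w without prefix in Z,
-- and also the prefixes of w without suffix in Z.  Hence δ_Z grows by 0 or 1
-- when a letter is added at either end.
--
-- Necessity.  Let X have F-degree d.  If p y s ∈ X with p, s nonempty and
-- δ_X(y) = d, then p y has a prefix in X, which contradicts p y s ∈ X; so
-- δ_X < d on K(X).  If K(X) were F-maximal, then X = K(X) and δ_X < d on X.
-- A shortest w with δ_X(w) = d has no prefix in X.  For w v w ∈ F the word
-- w v w has a prefix x ∈ X, and x extends w, so δ_X(x) = d, a contradiction.
--
-- Sufficiency.  Let X = Y ∪ G, where G is the set of factor-minimal words of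
-- F with δ_Y > d.  Since Y is not F-maximal, δ_Y is unbounded on F.  This
-- lets every y ∈ Y be extended on both sides to a word of G, and
-- δ_X = min(d, δ_Y) on F.

module Submission where

open import Defs
open import Axiom.ExcludedMiddle using (ExcludedMiddle)
open import Data.Empty using (⊥-elim)
open import Data.Fin.Base using (Fin)
open import Data.List.Base using (List; []; _∷_; [_]; _++_; _∷ʳ_; concat; length; map; initLast; _∷ʳ′_)
open import Data.List.Membership.Propositional using () renaming (_∈_ to _∈ˡ_)
open import Data.List.Membership.Propositional.Properties using (∈-map⁺; ∈-map⁻)
open import Data.List.Membership.Propositional.Properties.WithK using (unique∧set⇒bag)
open import Data.List.Properties using (++-assoc; ++-identityʳ; ++-identityʳ-unique; ++-identityˡ-unique; ++-cancelˡ; ++-conicalˡ; ++-conicalʳ; ∷-injective; ∷ʳ-injectiveˡ; length-map)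
open import Data.List.Relation.Binary.BagAndSetEquality using (∼bag⇒↭)
open import Data.List.Relation.Binary.Permutation.Propositional.Properties using (↭-length)
open import Data.List.Relation.Unary.All as All using ([]; _∷_)
open import Data.List.Relation.Unary.Any using (here; there)
open import Data.List.Relation.Unary.AllPairs using ([]; _∷_)
open import Data.List.Relation.Unary.Unique.Propositional using (Unique)
open import Data.List.Relation.Unary.Unique.Propositional.Properties using (map⁺)
open import Data.Nat.Base using (ℕ; zero; suc; _+_; _≤_; _<_; _∸_; _⊓_; z≤n; s≤s; s≤s⁻¹)
open import Data.Nat.Properties using (≤-refl; ≤-reflexive; ≤-trans; ≤-antisym; <⇒≤; <⇒≱; ≰⇒>; ≮⇒≥; _≤?_; _<?_; m≤n+m; +-monoˡ-≤; n≤1+n; m≤n⇒m⊓n≡m; m≥n⇒m⊓n≡n; m⊓n≤m; +-assoc; +-comm)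
open import Data.Product.Base using (∃-syntax; _×_; _,_; proj₁; proj₂)
open import Data.Sum.Base using (_⊎_; inj₁; inj₂)
open import Function.Base using (_∘_; case_of_)
open import Function.Bundles using (_⇔_; _↔_; mk⇔)
open import Function.Construct.Composition using (_⇔-∘_)
open import Function.Construct.Symmetry using (⇔-sym)
open import Level using (0ℓ)
open import Relation.Binary.PropositionalEquality.Core using (_≡_; _≢_; refl; sym; trans; cong; cong₂; subst)
open import Relation.Nullary.Decidable.Core using (Dec; yes; no)
open import Relation.Nullary.Negation.Core using (¬_; contradiction)
open import Relation.Unary using (_∈_; _∉_; _⊆_; _≐_; _∪_; ｛_｝)

module _ {A : Set} where

  -- Factorisations of words and code words at their ends.

  Prefixed Suffixed : Language A → Language A
  Prefixed Z w = ∃[ p ] (p IsPrefixOf w × p ∈ Z)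
  Suffixed Z w = ∃[ s ] (s IsSuffixOf w × s ∈ Z)

  levi : ∀ (p : Word A) {s} q {t} → p ++ s ≡ q ++ t →
         (∃[ r ] (q ≡ p ++ r × s ≡ r ++ t)) ⊎ (∃[ r ] (p ≡ q ++ r × t ≡ r ++ s))
  levi []      q       eq = inj₁ (q , refl , eq)
  levi (a ∷ p) []      eq = inj₂ (a ∷ p , refl , sym eq)
  levi (a ∷ p) (b ∷ q) eq with ∷-injective eq
  ... | refl , eq′ with levi p q eq′
  ...   | inj₁ (r , refl , refl) = inj₁ (r , refl , refl)
  ...   | inj₂ (r , refl , refl) = inj₂ (r , refl , refl)

  Prefixed-++ : ∀ {Z w} s → Prefixed Z w → Prefixed Z (w ++ s)
  Prefixed-++ s (p , (t , refl) , p∈Z) = p , (t ++ s , ++-assoc p t s) , p∈Z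

  Prefixed-∷ʳ⁻ : ∀ {Z} w b → Prefixed Z (w ∷ʳ b) → Prefixed Z w ⊎ (w ∷ʳ b) ∈ Z
  Prefixed-∷ʳ⁻ {Z} w b (p , (s , eq) , p∈Z) with initLast s
  ... | []      = inj₂ (subst Z (sym (trans eq (++-identityʳ p))) p∈Z)
  ... | t ∷ʳ′ c = inj₁ (p , (t , ∷ʳ-injectiveˡ w (p ++ t) (trans eq (sym (++-assoc p t [ c ])))) , p∈Z)

  Suffixed-∷ : ∀ {Z w} a → Suffixed Z w → Suffixed Z (a ∷ w)
  Suffixed-∷ a (s , (p , refl) , s∈Z) = s , (a ∷ p , refl) , s∈Z

  Suffixed-∷⁻ : ∀ {Z} a w → Suffixed Z (a ∷ w) → Suffixed Z w ⊎ (a ∷ w) ∈ Z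
  Suffixed-∷⁻ a w (s , ([]    , refl) , s∈Z) = inj₂ s∈Z
  Suffixed-∷⁻ a w (s , (_ ∷ p , refl) , s∈Z) = inj₁ (s , (p , refl) , s∈Z)

  ∈⇒Prefixed : ∀ {Z w} → w ∈ Z → Prefixed Z w
  ∈⇒Prefixed {w = w} w∈Z = w , ([] , sym (++-identityʳ w)) , w∈Z

  ∈⇒Suffixed : ∀ {Z w} → w ∈ Z → Suffixed Z w
  ∈⇒Suffixed {w = w} w∈Z = w , ([] , refl) , w∈Z

  -- Elementary properties of bifix codes.

  module _ {Z : Language A} (Z-bifix : BifixCode Z) where

    open BifixCode Z-bifix

    prefix-trivial : ∀ x {s} → x ∈ Z → (x ++ s) ∈ Z → s ≡ []
    prefix-trivial x {[]}    _   _    = refl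
    prefix-trivial x {c ∷ s} x∈Z xs∈Z = ⊥-elim (prefix x _ x∈Z xs∈Z
      ((c ∷ s , refl) , λ eq → case ++-identityʳ-unique x eq of λ ()))

    suffix-trivial : ∀ p {x} → x ∈ Z → (p ++ x) ∈ Z → p ≡ []
    suffix-trivial []      _   _    = refl
    suffix-trivial (c ∷ p) x∈Z px∈Z = ⊥-elim (suffix _ _ x∈Z px∈Z
      ((c ∷ p , refl) , λ eq → case ++-identityˡ-unique (c ∷ p) eq of λ ()))

    prefixes-equal : ∀ x {s} y {t} → x ∈ Z → y ∈ Z → x ++ s ≡ y ++ t → x ≡ y
    prefixes-equal x y x∈Z y∈Z eq with levi x y eq
    ... | inj₁ (r , refl , _) rewrite prefix-trivial x x∈Z y∈Z = sym (++-identityʳ x)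
    ... | inj₂ (r , refl , _) rewrite prefix-trivial y y∈Z x∈Z = ++-identityʳ y

    []-unprefixed : ¬ Prefixed Z []
    []-unprefixed ([] , _ , p∈Z) = []∉ p∈Z

    []-unsuffixed : ¬ Suffixed Z []
    []-unsuffixed ([]    , _ , s∈Z)            = []∉ s∈Z
    []-unsuffixed (_ ∷ _ , ([] , ()) , _)
    []-unsuffixed (_ ∷ _ , (_ ∷ _ , ()) , _)

  -- Two duplicate-free lists with the same members are permutations of each other.
  ParseCount-unique : ∀ {Z : Language A} {w m n} → ParseCount Z w m → ParseCount Z w n → m ≡ n
  ParseCount-unique (ts , ts! , ts⇔ , refl) (us , us! , us⇔ , refl) =
    ↭-length (∼bag⇒↭ (unique∧set⇒bag ts! us! λ {(v , z , u)} → ⇔-sym (us⇔ v z u) ⇔-∘ ts⇔ v z u))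

  module Classical (em : ExcludedMiddle 0ℓ) where

    -- The function `δ` and its growth to the left.

    missing : Set → ℕ
    missing P = case em {P} of λ where
      (yes _) → 0
      (no _)  → 1

    missing-yes : ∀ {P} → P → missing P ≡ 0
    missing-yes {P} p with em {P}
    ... | yes _ = refl
    ... | no ¬p = contradiction p ¬p

    missing-no : ∀ {P} → ¬ P → missing P ≡ 1
    missing-no {P} ¬p with em {P}
    ... | yes p = contradiction p ¬p
    ... | no _  = refl

    missing≤1 : ∀ P → missing P ≤ 1
    missing≤1 P with em {P}
    ... | yes _ = z≤n
    ... | no _  = ≤-refl

    missing-cong : ∀ {P Q} → (P → Q) → (Q → P) → missing P ≡ missing Q
    missing-cong {P} {Q} f g with em {Q}
    ... | yes q = missing-yes (g q)
    ... | no ¬q = missing-no (¬q ∘ f)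

    -- The value 1 at the empty word counts the empty suffix. For bifix codes, `δ-ParseCount`
    -- identifies `δ` with the number of parses.
    δ : Language A → Word A → ℕ
    δ Z []      = 1
    δ Z (a ∷ w) = missing (Prefixed Z (a ∷ w)) + δ Z w

    1≤δ : ∀ Z w → 1 ≤ δ Z w
    1≤δ Z []      = ≤-refl
    1≤δ Z (a ∷ w) = ≤-trans (1≤δ Z w) (m≤n+m _ _)

    module _ (Z : Language A) where

      δ-∷-prefixed : ∀ a w → Prefixed Z (a ∷ w) → δ Z (a ∷ w) ≡ δ Z w
      δ-∷-prefixed a w p = cong (_+ δ Z w) (missing-yes p)

      δ-∷-unprefixed : ∀ a w → ¬ Prefixed Z (a ∷ w) → δ Z (a ∷ w) ≡ suc (δ Z w)
      δ-∷-unprefixed a w p = cong (_+ δ Z w) (missing-no p)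

      δ-∷-≤ : ∀ a w → δ Z (a ∷ w) ≤ suc (δ Z w)
      δ-∷-≤ a w = +-monoˡ-≤ (δ Z w) (missing≤1 _)

      δ-++ˡ : ∀ p w → δ Z w ≤ δ Z (p ++ w)
      δ-++ˡ []      w = ≤-refl
      δ-++ˡ (a ∷ p) w = ≤-trans (δ-++ˡ p w) (m≤n+m _ _)

      -- A discrete intermediate value argument, letter by letter along `p`. It serves to cut out
      -- words that exceed the bound `n` only just, at a known letter.
      δ-crossingˡ : ∀ {n} p w → δ Z w ≤ n → n < δ Z (p ++ w) →
                    ∃[ a ] ∃[ q ] ((a ∷ q) IsSuffixOf p × δ Z (q ++ w) ≤ n × n < δ Z (a ∷ q ++ w))
      δ-crossingˡ     []      w lo hi = contradiction lo (<⇒≱ hi)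
      δ-crossingˡ {n} (a ∷ p) w lo hi with δ Z (p ++ w) ≤? n
      ... | yes lo′ = a , p , ([] , refl) , lo′ , hi
      ... | no ¬lo′ with δ-crossingˡ p w lo (≰⇒> ¬lo′)
      ...   | b , q , (r , refl) , bounds = b , q , (a ∷ r , refl) , bounds

    -- Left-right symmetry of `δ` for a bifix code.

    module _ {Z : Language A} (Z-bifix : BifixCode Z) where

      open BifixCode Z-bifix

      -- A word a w b of Z gains a prefix in Z with its last letter and a
      -- suffix in Z with its first; for other words neither changes.
      missing-square : ∀ a w b →
        missing (Prefixed Z (a ∷ w ∷ʳ b)) + missing (Suffixed Z (w ∷ʳ b)) ≡
        missing (Prefixed Z (a ∷ w)) + missing (Suffixed Z (a ∷ w ∷ʳ b))
      missing-square a w b with em {(a ∷ w ∷ʳ b) ∈ Z}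
      ... | yes x∈Z
        rewrite missing-yes (∈⇒Prefixed {Z} x∈Z)
              | missing-yes (∈⇒Suffixed {Z} x∈Z)
              | missing-no {Prefixed Z (a ∷ w)}
                  (λ { (p , (s , eq) , p∈Z) →
                    let x≡ = trans (cong (_∷ʳ b) eq) (++-assoc p s [ b ])
                    in case ++-conicalʳ s [ b ] (prefix-trivial Z-bifix p p∈Z (subst Z x≡ x∈Z)) of λ () })
              | missing-no {Suffixed Z (w ∷ʳ b)}
                  (λ { (s , (p , eq) , s∈Z) →
                    case suffix-trivial Z-bifix (a ∷ p) s∈Z (subst Z (cong (a ∷_) eq) x∈Z) of λ () })
        = refl
      ... | no x∉Z = cong₂ _+_
        (missing-cong
          (λ p → case Prefixed-∷ʳ⁻ (a ∷ w) b p of λ where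
            (inj₁ q) → q
            (inj₂ x∈Z) → contradiction x∈Z x∉Z)
          (Prefixed-++ [ b ]))
        (missing-cong
          (Suffixed-∷ a)
          (λ p → case Suffixed-∷⁻ a (w ∷ʳ b) p of λ where
            (inj₁ q) → q
            (inj₂ x∈Z) → contradiction x∈Z x∉Z))

      -- The mirror image of the defining recursion. In the induction on the word, `missing-square`
      -- exchanges the contributions of the first and the last letter.
      δ-∷ʳ : ∀ w b → δ Z (w ∷ʳ b) ≡ missing (Suffixed Z (w ∷ʳ b)) + δ Z w
      δ-∷ʳ [] b = cong (_+ 1) (missing-cong
        (λ p → case Prefixed-∷ʳ⁻ [] b p of λ where
          (inj₁ q) → contradiction q ([]-unprefixed Z-bifix)
          (inj₂ x∈Z) → ∈⇒Suffixed x∈Z)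
        (λ p → case Suffixed-∷⁻ b [] p of λ where
          (inj₁ q) → contradiction q ([]-unsuffixed Z-bifix)
          (inj₂ x∈Z) → ∈⇒Prefixed x∈Z))
      δ-∷ʳ (a ∷ w) b
        rewrite δ-∷ʳ w b
              | sym (+-assoc (missing (Prefixed Z (a ∷ w ∷ʳ b))) (missing (Suffixed Z (w ∷ʳ b))) (δ Z w))
              | missing-square a w b
              | +-comm (missing (Prefixed Z (a ∷ w))) (missing (Suffixed Z (a ∷ w ∷ʳ b)))
        = +-assoc (missing (Suffixed Z (a ∷ w ∷ʳ b))) _ (δ Z w)

      δ-∷ʳ-suffixed : ∀ w b → Suffixed Z (w ∷ʳ b) → δ Z (w ∷ʳ b) ≡ δ Z w
      δ-∷ʳ-suffixed w b s = trans (δ-∷ʳ w b) (cong (_+ δ Z w) (missing-yes s))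

      δ-∷ʳ-unsuffixed : ∀ w b → ¬ Suffixed Z (w ∷ʳ b) → δ Z (w ∷ʳ b) ≡ suc (δ Z w)
      δ-∷ʳ-unsuffixed w b ¬s = trans (δ-∷ʳ w b) (cong (_+ δ Z w) (missing-no ¬s))

      δ-∷ʳ-≤ : ∀ w b → δ Z (w ∷ʳ b) ≤ suc (δ Z w)
      δ-∷ʳ-≤ w b rewrite δ-∷ʳ w b = +-monoˡ-≤ (δ Z w) (missing≤1 _)

      δ-++ʳ : ∀ w s → δ Z w ≤ δ Z (w ++ s)
      δ-++ʳ w []      = ≤-reflexive (cong (δ Z) (sym (++-identityʳ w)))
      δ-++ʳ w (b ∷ s) = ≤-trans
        (≤-trans (m≤n+m _ _) (≤-reflexive (sym (δ-∷ʳ w b))))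
        (≤-trans (δ-++ʳ (w ∷ʳ b) s) (≤-reflexive (cong (δ Z) (++-assoc w [ b ] s))))

      δ-factor : ∀ p w s → δ Z w ≤ δ Z (p ++ w ++ s)
      δ-factor p w s = ≤-trans (δ-++ʳ w s) (δ-++ˡ Z p (w ++ s))

      δ-crossingʳ : ∀ {n} w s → δ Z w ≤ n → n < δ Z (w ++ s) →
                    ∃[ t ] ∃[ b ] ((t ∷ʳ b) IsPrefixOf s × δ Z (w ++ t) ≤ n × n < δ Z (w ++ t ∷ʳ b))
      δ-crossingʳ w [] lo hi = contradiction lo (<⇒≱ (subst (λ v → _ < δ Z v) (++-identityʳ w) hi))
      δ-crossingʳ {n} w (b ∷ s) lo hi with δ Z (w ∷ʳ b) ≤? n
      ... | no ¬lo′ = [] , b , (s , refl) , subst (λ v → δ Z v ≤ n) (sym (++-identityʳ w)) lo , ≰⇒> ¬lo′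
      ... | yes lo′ with δ-crossingʳ (w ∷ʳ b) s lo′ (subst (λ v → n < δ Z v) (sym (++-assoc w [ b ] s)) hi)
      ...   | t , c , (r , refl) , lo″ , hi″ =
        b ∷ t , c , (r , refl) ,
        subst (λ v → δ Z v ≤ n) (++-assoc w [ b ] t) lo″ ,
        subst (λ v → n < δ Z v) (++-assoc w [ b ] (t ∷ʳ c)) hi″

      -- Enumeration of all parses of a word.

      -- Adding a letter a in front of w turns a parse (v , z , u) of w into a
      -- parse of a w, the word a v being absorbed into z when it lies in Z.
      shift : A → Word A × Word A × Word A → Word A × Word A × Word A
      shift a (v , z , u) = case em {(a ∷ v) ∈ Z} of λ where
        (yes _) → [] , (a ∷ v) ++ z , u
        (no _)  → a ∷ v , z , u

      -- If both code words are absorbed, they are prefixes of the same word and hence equal. If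
      -- just one is, only one of the two left components is empty.
      shift-injective : ∀ a {t t′} → shift a t ≡ shift a t′ → t ≡ t′
      shift-injective a {v , z , u} {v′ , z′ , u′} eq with em {(a ∷ v) ∈ Z} | em {(a ∷ v′) ∈ Z}
      shift-injective a refl | no _ | no _ = refl
      shift-injective a {v , z , u} {v′ , z′ , u′} eq | yes av∈Z | yes av′∈Z
        with refl ← cong (proj₂ ∘ proj₂) eq
        with refl ← prefixes-equal Z-bifix (a ∷ v) (a ∷ v′) av∈Z av′∈Z (cong (proj₁ ∘ proj₂) eq)
        = cong (λ y → v , y , u) (++-cancelˡ (a ∷ v) z z′ (cong (proj₁ ∘ proj₂) eq))

      -- The letter `a` ends up in the left or the middle component, so one of these is nonempty.
      shift≢ : ∀ a t w → ([] , [] , w) ≢ shift a t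
      shift≢ a (v , z , u) w eq with em {(a ∷ v) ∈ Z}
      shift≢ a (v , z , u) w () | yes _
      shift≢ a (v , z , u) w () | no _

      -- The only parse not obtained by `shift` has `u = w`, and it exists just when `w` has no
      -- prefix in `Z`.
      addWhole : ∀ {w} → Dec (Prefixed Z w) → List (Word A × Word A × Word A) → List (Word A × Word A × Word A)
      addWhole     (yes _) ts = ts
      addWhole {w} (no _)  ts = ([] , [] , w) ∷ ts

      parses : Word A → List (Word A × Word A × Word A)
      parses []      = [ [] , [] , [] ]
      parses (a ∷ w) = addWhole {a ∷ w} em (map (shift a) (parses w))

      length-parses : ∀ w → length (parses w) ≡ δ Z w
      length-parses []      = refl
      length-parses (a ∷ w) with em {Prefixed Z (a ∷ w)}
      ... | yes _ = trans (length-map (shift a) (parses w)) (length-parses w)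
      ... | no _  = cong suc (trans (length-map (shift a) (parses w)) (length-parses w))

      parses-unique : ∀ w → Unique (parses w)
      parses-unique []      = [] ∷ []
      parses-unique (a ∷ w) with em {Prefixed Z (a ∷ w)}
      ... | yes _ = map⁺ (shift-injective a) (parses-unique w)
      ... | no _  = All.tabulate (λ t∈ eq → case ∈-map⁻ (shift a) t∈ of λ where
                      (t , _ , refl) → shift≢ a t (a ∷ w) eq)
                  ∷ map⁺ (shift-injective a) (parses-unique w)

      Parse : Word A → Word A × Word A × Word A → Set
      Parse w (v , z , u) = IsParse Z w v z u

      shift-parse : ∀ a w t → Parse w t → Parse (a ∷ w) (shift a t)
      shift-parse a w (v , z , u) record { factorisation = refl ; left = l ; middle = zs , zs∈Z , refl ; right = r }
        with em {(a ∷ v) ∈ Z}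
      ... | yes av∈Z = record
        { factorisation = cong (a ∷_) (sym (++-assoc v z u))
        ; left   = λ s s⊒ s∈Z → []-unsuffixed Z-bifix (s , s⊒ , s∈Z)
        ; middle = (a ∷ v) ∷ zs , av∈Z ∷ zs∈Z , refl
        ; right  = r }
      ... | no av∉Z = record
        { factorisation = refl
        ; left   = λ s s⊒ s∈Z → case Suffixed-∷⁻ a v (s , s⊒ , s∈Z) of λ where
            (inj₁ (s′ , s′⊒ , s′∈Z)) → l s′ s′⊒ s′∈Z
            (inj₂ av∈Z)              → av∉Z av∈Z
        ; middle = zs , zs∈Z , refl
        ; right  = r }

      parses-sound : ∀ w {t} → t ∈ˡ parses w → Parse w t
      parses-sound [] (here refl) = record
        { factorisation = refl
        ; left   = λ s s⊒ s∈Z → []-unsuffixed Z-bifix (s , s⊒ , s∈Z)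
        ; middle = [] , [] , refl
        ; right  = λ p p⊑ p∈Z → []-unprefixed Z-bifix (p , p⊑ , p∈Z) }
      parses-sound (a ∷ w) t∈ with em {Prefixed Z (a ∷ w)}
      parses-sound (a ∷ w) t∈ | yes _ with ∈-map⁻ (shift a) t∈
      ... | t , t∈′ , refl = shift-parse a w t (parses-sound w t∈′)
      parses-sound (a ∷ w) (here refl) | no ¬p = record
        { factorisation = refl
        ; left   = λ s s⊒ s∈Z → []-unsuffixed Z-bifix (s , s⊒ , s∈Z)
        ; middle = [] , [] , refl
        ; right  = λ p p⊑ p∈Z → ¬p (p , p⊑ , p∈Z) }
      parses-sound (a ∷ w) (there t∈) | no _ with ∈-map⁻ (shift a) t∈
      ... | t , t∈′ , refl = shift-parse a w t (parses-sound w t∈′)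

      ∈-addWhole : ∀ {w t ts} (p? : Dec (Prefixed Z w)) → t ∈ˡ ts → t ∈ˡ addWhole p? ts
      ∈-addWhole (yes _) t∈ = t∈
      ∈-addWhole (no _)  t∈ = there t∈

      shift-absorbs : ∀ a v z u → (a ∷ v) ∈ Z → shift a (v , z , u) ≡ ([] , a ∷ v ++ z , u)
      shift-absorbs a v z u av∈Z with em {(a ∷ v) ∈ Z}
      ... | yes _   = refl
      ... | no av∉Z = contradiction av∈Z av∉Z

      shift-keeps : ∀ a v z u → (a ∷ v) ∉ Z → shift a (v , z , u) ≡ (a ∷ v , z , u)
      shift-keeps a v z u av∉Z with em {(a ∷ v) ∈ Z}
      ... | yes av∈Z = contradiction av∈Z av∉Z
      ... | no _     = refl

      -- The first letter belongs to `v`, to the first code word of `z`, or to `u`. In the first two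
      -- cases removing it gives a parse of the tail; in the third the parse is the one from
      -- `addWhole`.
      parses-complete : ∀ w v z u → IsParse Z w v z u → (v , z , u) ∈ˡ parses w
      parses-complete [] v z u π
        with refl ← ++-conicalˡ v (z ++ u) (sym (IsParse.factorisation π))
        with refl ← ++-conicalˡ z u (sym (IsParse.factorisation π))
        with refl ← IsParse.factorisation π = here refl
      parses-complete (a ∷ w) (_ ∷ v) z u record { factorisation = refl ; left = l ; middle = m ; right = r } =
        ∈-addWhole em (subst (_∈ˡ map (shift a) (parses w))
          (shift-keeps a v z u (l (a ∷ v) ([] , refl)))
          (∈-map⁺ (shift a) (parses-complete w v z u (record
            { factorisation = refl
            ; left   = λ { s (p , refl) → l s (a ∷ p , refl) }
            ; middle = m
            ; right  = r }))))
      parses-complete (a ∷ w) [] z u record { middle = [] ∷ zs , z∈Z ∷ _ , refl } = contradiction z∈Z []∉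
      parses-complete (a ∷ w) [] z u record { factorisation = refl ; middle = [] , _ , refl ; right = r }
        with em {Prefixed Z (a ∷ w)}
      ... | yes (p , p⊑ , p∈Z) = contradiction p∈Z (r p p⊑)
      ... | no _               = here refl
      parses-complete (a ∷ w) [] z u record { factorisation = refl ; middle = (_ ∷ v) ∷ zs , av∈Z ∷ zs∈Z , refl ; right = r } =
        ∈-addWhole em (subst (_∈ˡ map (shift a) (parses w))
          (shift-absorbs a v (concat zs) u av∈Z)
          (∈-map⁺ (shift a) (parses-complete w v (concat zs) u (record
            { factorisation = ++-assoc v (concat zs) u
            -- A suffix of `v` in `Z` would be a proper suffix of the code word `a ∷ v`.
            ; left   = λ { s (p , refl) s∈Z → case suffix-trivial Z-bifix (a ∷ p) s∈Z av∈Z of λ () }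
            ; middle = zs , zs∈Z , refl
            ; right  = r }))))

      δ-ParseCount : ∀ w → ParseCount Z w (δ Z w)
      δ-ParseCount w = parses w , parses-unique w ,
        (λ v z u → mk⇔ (parses-sound w) (parses-complete w v z u)) , length-parses w

      ParsesBoundedOn⇒δ≤ : ∀ {W n} → ParsesBoundedOn W Z n → ∀ {w} → w ∈ W → δ Z w ≤ n
      ParsesBoundedOn⇒δ≤ bounded {w} w∈W with bounded w w∈W
      ... | m , count , m≤n = ≤-trans (≤-reflexive (ParseCount-unique (δ-ParseCount w) count)) m≤n

      δ≤⇒ParsesBoundedOn : ∀ {W n} → (∀ {w} → w ∈ W → δ Z w ≤ n) → ParsesBoundedOn W Z n
      δ≤⇒ParsesBoundedOn bounded w w∈W = δ Z w , δ-ParseCount w , bounded w∈W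

    module _ {F : Language A} (F-recurrent : Recurrent F) where

      open Recurrent F-recurrent

      F-prefix : ∀ {w} s → (w ++ s) ∈ F → w ∈ F
      F-prefix {w} s = factorial [] w s

      F-suffix : ∀ p {w} → (p ++ w) ∈ F → w ∈ F
      F-suffix p {w} pw∈F = factorial p w [] (subst F (cong (p ++_) (sym (++-identityʳ w))) pw∈F)

      -- Necessity: codes of finite degree and their kernels.

      module _ {X : Language A} (X-bifix : BifixCode X) (X⊆F : X ⊆ F) {d : ℕ} (X-degree : HasDegree F X d) where

        δX≤d : ∀ {w} → w ∈ F → δ X w ≤ d
        δX≤d = ParsesBoundedOn⇒δ≤ X-bifix (proj₂ X-degree)

        -- Otherwise the first letter of `p` would raise `δ X` above the degree.
        full⇒prefixed : ∀ p w → p ≢ [] → (p ++ w) ∈ F → d ≤ δ X w → Prefixed X (p ++ w)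
        full⇒prefixed []      w p≢[] _    _    = contradiction refl p≢[]
        full⇒prefixed (a ∷ p) w _    pw∈F full with em {Prefixed X (a ∷ p ++ w)}
        ... | yes prefixed = prefixed
        ... | no ¬prefixed = contradiction (δX≤d pw∈F) (<⇒≱ (subst (d <_)
                (sym (δ-∷-unprefixed X a (p ++ w) ¬prefixed)) (s≤s (≤-trans full (δ-++ˡ X p w)))))

        kernel-δ< : ∀ {y} → y ∈ Kernel X → δ X y < d
        kernel-δ< {y} (_ , p , s , p≢[] , s≢[] , x∈X) with δ X y <? d
        ... | yes below = below
        ... | no ¬below
          with pys≡ ← sym (++-assoc p y s)
          with q , (r , eq) , q∈X ← full⇒prefixed p y p≢[] (F-prefix s (subst F pys≡ (X⊆F x∈X))) (≮⇒≥ ¬below)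
          = contradiction
              (++-conicalʳ r s (prefix-trivial X-bifix q q∈X
                (subst X (trans pys≡ (trans (cong (_++ s) eq) (++-assoc q r s))) x∈X)))
              s≢[]

        -- Since `y` lies strictly inside a word of `X`, every word of `X` that is a factor of `y`
        -- does too, and so belongs to the kernel. Hence `X` and `Y` have the same words among the
        -- factors of `y`.
        kernel-δ : ∀ {Y y} → Kernel X ⊆ Y → Y ⊆ X → ∀ w → w IsSuffixOf y → y ∈ Kernel X → δ Y w ≡ δ X w
        kernel-δ K⊆Y Y⊆X []      _          _   = refl
        kernel-δ {Y} K⊆Y Y⊆X (a ∷ w) (p , refl) y∈K@(_ , l , r , l≢[] , r≢[] , x∈X) = cong₂ _+_
          (missing-cong
            (λ { (q , q⊑ , q∈Y) → q , q⊑ , Y⊆X q∈Y })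
            (λ { (q , (s , eq) , q∈X) → q , (s , eq) , K⊆Y
                 ( q∈X , l ++ p , s ++ r
                 , l≢[] ∘ ++-conicalˡ l p , r≢[] ∘ ++-conicalʳ s r
                 , subst X (reassociate q s eq) x∈X) }))
          (kernel-δ K⊆Y Y⊆X w (p ∷ʳ a , sym (++-assoc p [ a ] w)) y∈K)
          where
          reassociate : ∀ q s → a ∷ w ≡ q ++ s → l ++ (p ++ a ∷ w) ++ r ≡ (l ++ p) ++ q ++ s ++ r
          reassociate q s eq rewrite eq | ++-assoc p (q ++ s) r | ++-assoc q s r = sym (++-assoc l p (q ++ s ++ r))

        -- Deleting the first letter of a word with a prefix in `X` keeps `δ X`. The deletion stops
        -- at an unprefixed word or at `[]`, where `δ X` is 1.
        full-unprefixed : ∀ w → w ∈ F → d ≤ δ X w →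
          d ≤ 1 ⊎ ∃[ a ] ∃[ v ] ((a ∷ v) ∈ F × d ≤ δ X (a ∷ v) × ¬ Prefixed X (a ∷ v))
        full-unprefixed []      _   full = inj₁ full
        full-unprefixed (a ∷ w) w∈F full with em {Prefixed X (a ∷ w)}
        ... | yes prefixed = full-unprefixed w (F-suffix [ a ] w∈F) full
        ... | no ¬prefixed = inj₂ (a , w , w∈F , ≤-trans full (≤-reflexive (sym (δ-∷-unprefixed X a w ¬prefixed))) , ¬prefixed)

        δX<d⇒trivial : (∀ {x} → x ∈ X → δ X x < d) → F ≐ ｛ [] ｝ × d ≤ 1
        δX<d⇒trivial below with proj₁ X-degree
        ... | w , w∈F , count with full-unprefixed w w∈F (≤-reflexive (ParseCount-unique count (δ-ParseCount X-bifix w)))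
        ...   | inj₁ d≤1 = ((λ {u} → F⊆ u) , λ { refl → F-prefix w w∈F }) , d≤1
          where
          -- As `δ X` is at least 1 everywhere, no word can have `δ X x < d`.
          X-empty : ∀ {x} → x ∉ X
          X-empty {x} x∈X = <⇒≱ (below x∈X) (≤-trans d≤1 (1≤δ X x))
          F⊆ : ∀ u → u ∈ F → [] ≡ u
          F⊆ []      _   = refl
          F⊆ (a ∷ u) u∈F = contradiction (δX≤d u∈F) (<⇒≱ (subst (d <_)
            (sym (δ-∷-unprefixed X a u λ { (_ , _ , x∈X) → X-empty x∈X })) (s≤s (≤-trans d≤1 (1≤δ X u)))))
        ...   | inj₂ (a , v , av∈F , full , ¬prefixed)
          with t , _ , avtav∈F ← recurrent (a ∷ v) (a ∷ v) av∈F av∈F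
          with x , (s , eq) , x∈X ← full⇒prefixed (a ∷ v) (t ++ a ∷ v) (λ ()) avtav∈F (≤-trans full (δ-++ˡ X t (a ∷ v)))
          with levi (a ∷ v) x eq
        -- Either `x` extends `a ∷ v` and inherits its full count, or `x` is a prefix of this
        -- unprefixed word.
        ... | inj₁ (r , refl , _)  = contradiction (≤-trans full (δ-++ʳ X-bifix (a ∷ v) r)) (<⇒≱ (below x∈X))
        ... | inj₂ (r , av≡xr , _) = contradiction (x , (r , av≡xr) , x∈X) ¬prefixed

      -- Sufficiency: unbounded parse counts from non-maximality.

      module _ {Y : Language A} (Y-bifix : BifixCode Y) (Y⊆F : Y ⊆ F) where

        PrefixIncomparable : Language A
        PrefixIncomparable w = w ∈ F × ∀ y → y ∈ Y → ¬ (y IsPrefixOf w) × ¬ (w IsPrefixOf y)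

        -- Any word outside `Y` of a bifix code in `F` containing `Y` is such a word. If there is
        -- none, `Y` is maximal.
        nonmaximal⇒incomparable : ¬ MaximalBifixCode F Y → ∃[ a ] ∃[ v ] (a ∷ v) ∈ PrefixIncomparable
        nonmaximal⇒incomparable ¬maximal with em {∃[ a ] ∃[ v ] (a ∷ v) ∈ PrefixIncomparable}
        ... | yes found = found
        ... | no ¬found = contradiction (record
          { bifix   = Y-bifix
          ; inside  = Y⊆F
          ; maximal = λ { (Z , Z-bifix , Z⊆F , Y⊆Z , Z⊈Y) → Z⊈Y λ {z} → inY Z-bifix Z⊆F Y⊆Z z } }) ¬maximal
          where
          inY : ∀ {Z} → BifixCode Z → Z ⊆ F → Y ⊆ Z → ∀ z → z ∈ Z → z ∈ Y
          inY Z-bifix Z⊆F Y⊆Z []      z∈Z = contradiction z∈Z (BifixCode.[]∉ Z-bifix)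
          inY Z-bifix Z⊆F Y⊆Z (a ∷ v) z∈Z with em {(a ∷ v) ∈ Y}
          ... | yes z∈Y = z∈Y
          ... | no z∉Y  = contradiction
            (a , v , Z⊆F z∈Z , λ y y∈Y →
              (λ y⊑z → BifixCode.prefix Z-bifix y (a ∷ v) (Y⊆Z y∈Y) z∈Z (y⊑z , λ { refl → z∉Y y∈Y })) ,
              (λ z⊑y → BifixCode.prefix Z-bifix (a ∷ v) y z∈Z (Y⊆Z y∈Y) (z⊑y , λ { refl → z∉Y y∈Y })))
            ¬found

        -- Put an incomparable word in front of `u`. The result has no prefix in `Y`, since such a
        -- prefix would be comparable with that word; so its first letter adds 1.
        δ-unbounded : ¬ MaximalBifixCode F Y → ∀ n → ∃[ u ] (u ∈ F × n ≤ δ Y u)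
        δ-unbounded ¬maximal zero    = proj₁ nonempty , proj₂ nonempty , z≤n
        δ-unbounded ¬maximal (suc n)
          with u , u∈F , n≤ ← δ-unbounded ¬maximal n
          with a , v , w∈F , incomparable ← nonmaximal⇒incomparable ¬maximal
          with t , _ , wtu∈F ← recurrent (a ∷ v) u w∈F u∈F
          = (a ∷ v) ++ t ++ u , wtu∈F , subst (suc n ≤_) (sym (δ-∷-unprefixed Y a (v ++ t ++ u) ¬prefixed))
              (s≤s (≤-trans n≤ (≤-trans (δ-++ˡ Y t u) (δ-++ˡ Y v (t ++ u)))))
          where
          ¬prefixed : ¬ Prefixed Y (a ∷ v ++ t ++ u)
          ¬prefixed (y , (s , eq) , y∈Y) with levi (a ∷ v) y eq
          ... | inj₁ (r , y≡ , _) = proj₂ (incomparable y y∈Y) (r , y≡)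
          ... | inj₂ (r , w≡ , _) = proj₁ (incomparable y y∈Y) (r , w≡)

        -- Minimal words with more than `d` parses.

        module _ (d : ℕ) where

          Overfull : Language A
          Overfull x = x ∈ F × d < δ Y x × (∀ p u s → x ≡ p ++ u ++ s → d < δ Y u → p ≡ [] × s ≡ [])

          -- Every proper factor avoids the first or the last letter, so by monotonicity of `δ` only
          -- two factors have to be tested.
          overfull : ∀ a w w′ b → a ∷ w ≡ w′ ∷ʳ b → (a ∷ w) ∈ F → d < δ Y (a ∷ w) →
                     δ Y w ≤ d → δ Y w′ ≤ d → (a ∷ w) ∈ Overfull
          overfull a w w′ b w≡w′ x∈F d<δ δw≤d δw′≤d = x∈F , d<δ , minimal
            where
            minimal : ∀ p u s → a ∷ w ≡ p ++ u ++ s → d < δ Y u → p ≡ [] × s ≡ []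
            minimal (_ ∷ p) u s refl d<δu = contradiction (≤-trans (δ-factor Y-bifix p u s) δw≤d) (<⇒≱ d<δu)
            minimal []      u s eq   d<δu with initLast s
            ... | []      = refl , refl
            ... | t ∷ʳ′ c with refl ← ∷ʳ-injectiveˡ w′ (u ++ t) (trans (sym w≡w′) (trans eq (sym (++-assoc u t [ c ]))))
              = contradiction (≤-trans (δ-++ʳ Y-bifix u t) δw′≤d) (<⇒≱ d<δu)

          -- Deleting the first letter of a prefixed word keeps the count, against minimality.
          Overfull-unprefixed : ∀ {x} → x ∈ Overfull → ¬ Prefixed Y x
          Overfull-unprefixed {[]}    _                   prefixed = []-unprefixed Y-bifix prefixed
          Overfull-unprefixed {a ∷ w} (_ , d<δ , minimal) prefixed =
            case minimal [ a ] w [] (cong (a ∷_) (sym (++-identityʳ w))) (subst (d <_) (δ-∷-prefixed Y a w prefixed) d<δ) of λ ()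

          Overfull-unsuffixed : ∀ {x} → x ∈ Overfull → ¬ Suffixed Y x
          Overfull-unsuffixed {x} (_ , d<δ , minimal) suffixed with initLast x
          ... | []      = []-unsuffixed Y-bifix suffixed
          ... | w ∷ʳ′ b =
            case minimal [] w [ b ] refl (subst (d <_) (δ-∷ʳ-suffixed Y-bifix w b suffixed) d<δ) of λ ()

        -- The completion of `Y` to a code of degree `suc e`.

        module _ (e : ℕ) (bounded : ∀ {y} → y ∈ Y → δ Y y ≤ e) where

          Completion : Language A
          Completion = Y ∪ Overfull (suc e)

          -- Words of `Y` have too few parses to contain `g`, and overfull words are minimal.
          Overfull-not-inner : ∀ {x} p g s → g ∈ Overfull (suc e) → x ∈ Completion → x ≡ p ++ g ++ s → p ≡ [] × s ≡ []
          Overfull-not-inner p g s (_ , d<δ , _) (inj₁ x∈Y) refl =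
            contradiction (≤-trans (δ-factor Y-bifix p g s) (bounded x∈Y)) (<⇒≱ (<⇒≤ d<δ))
          Overfull-not-inner p g s (_ , d<δ , _) (inj₂ (_ , _ , minimal)) eq = minimal p g s eq d<δ

          Completion⊆F : Completion ⊆ F
          Completion⊆F (inj₁ x∈Y)       = Y⊆F x∈Y
          Completion⊆F (inj₂ (x∈F , _)) = x∈F

          Completion-bifix : BifixCode Completion
          Completion-bifix = record { []∉ = []∉Completion ; prefix = prefix ; suffix = suffix }
            where
            []∉Completion : [] ∉ Completion
            []∉Completion (inj₁ []∈Y)               = BifixCode.[]∉ Y-bifix []∈Y
            []∉Completion (inj₂ (_ , s≤s () , _))

            prefix : ∀ x y → x ∈ Completion → y ∈ Completion → ¬ (x IsProperPrefixOf y)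
            prefix x y (inj₁ x∈Y) (inj₁ y∈Y) x⊏y       = BifixCode.prefix Y-bifix x y x∈Y y∈Y x⊏y
            prefix x y (inj₁ x∈Y) (inj₂ y∈G) (x⊑y , _) = Overfull-unprefixed (suc e) y∈G (x , x⊑y , x∈Y)
            prefix x y (inj₂ x∈G) y∈X ((s , refl) , x≢y)
              with _ , refl ← Overfull-not-inner [] x s x∈G y∈X refl = x≢y (sym (++-identityʳ x))

            suffix : ∀ x y → x ∈ Completion → y ∈ Completion → ¬ (x IsProperSuffixOf y)
            suffix x y (inj₁ x∈Y) (inj₁ y∈Y) x⊐y       = BifixCode.suffix Y-bifix x y x∈Y y∈Y x⊐y
            suffix x y (inj₁ x∈Y) (inj₂ y∈G) (x⊒y , _) = Overfull-unsuffixed (suc e) y∈G (x , x⊒y , x∈Y)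
            suffix x y (inj₂ x∈G) y∈X ((p , refl) , x≢y)
              with refl , _ ← Overfull-not-inner p x [] x∈G y∈X (cong (p ++_) (sym (++-identityʳ x))) = x≢y refl

          -- The shortest prefix of `a ∷ w` whose count exceeds `suc e` is overfull.
          overfull-prefix : ∀ a w → (a ∷ w) ∈ F → ¬ Prefixed Y (a ∷ w) → suc e ≤ δ Y w → Prefixed Completion (a ∷ w)
          overfull-prefix a w x∈F ¬prefixed full
            with δ-crossingʳ Y-bifix {suc e} [] (a ∷ w) (s≤s z≤n)
                   (subst (suc e <_) (sym (δ-∷-unprefixed Y a w ¬prefixed)) (s≤s full))
          ... | [] , b , (r , refl) , _ , hi = [ b ] , (r , refl) , inj₂
            (overfull (suc e) b [] [] b refl (F-prefix r x∈F) hi (s≤s z≤n) (s≤s z≤n))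
          ... | _ ∷ t , b , (r , refl) , lo , hi = a ∷ t ∷ʳ b , (r , refl) , inj₂
            (overfull (suc e) a (t ∷ʳ b) (a ∷ t) b refl (F-prefix r x∈F) hi
              -- The last letter brings the count to at most `suc (suc e)`; deleting `a` lowers it
              -- by exactly 1, as there is no prefix in `Y`.
              (s≤s⁻¹ (subst (_≤ suc (suc e)) (δ-∷-unprefixed Y a (t ∷ʳ b) (¬prefixed ∘ Prefixed-++ r))
                (≤-trans (δ-∷ʳ-≤ Y-bifix (a ∷ t) b) (s≤s lo))))
              lo)

          unfull⇒unprefixed : ∀ a w → ¬ Prefixed Y (a ∷ w) → δ Y w < suc e → ¬ Prefixed Completion (a ∷ w)
          unfull⇒unprefixed a w ¬prefixed unfull (p , p⊑ , inj₁ p∈Y) = ¬prefixed (p , p⊑ , p∈Y)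
          unfull⇒unprefixed a w ¬prefixed unfull (p , (s , eq) , inj₂ (_ , d<δ , _)) = <⇒≱ d<δ (≤-trans
            (≤-trans (δ-++ʳ Y-bifix p s) (≤-reflexive (cong (δ Y) (sym eq))))
            (≤-trans (δ-∷-≤ Y a w) unfull))

          -- When a letter is added in front and creates no prefix in `Y`, an overfull prefix
          -- appears just when `δ Y w` has already reached `suc e`. So the count grows with `δ Y` up
          -- to that value and then stays.
          δ-Completion : ∀ w → w ∈ F → δ Completion w ≡ suc e ⊓ δ Y w
          δ-Completion []      _ = sym (m≥n⇒m⊓n≡n (s≤s z≤n))
          δ-Completion (a ∷ w) x∈F with δ-Completion w (F-suffix [ a ] x∈F) | em {Prefixed Y (a ∷ w)}
          ... | ih | yes (y , y⊑ , y∈Y) = trans (δ-∷-prefixed Completion a w (y , y⊑ , inj₁ y∈Y)) ih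
          ... | ih | no ¬prefixed with suc e ≤? δ Y w
          ...   | yes full = trans (δ-∷-prefixed Completion a w (overfull-prefix a w x∈F ¬prefixed full))
                  (trans ih (trans (m≤n⇒m⊓n≡m full) (sym (m≤n⇒m⊓n≡m (≤-trans full (n≤1+n _))))))
          ...   | no ¬full = trans (δ-∷-unprefixed Completion a w (unfull⇒unprefixed a w ¬prefixed (≰⇒> ¬full)))
                  (trans (cong suc (trans ih (m≥n⇒m⊓n≡n (<⇒≤ (≰⇒> ¬full))))) (sym (m≥n⇒m⊓n≡n (≰⇒> ¬full))))

          -- Degree and kernel of the completion.

          module _ (¬maximal : ¬ MaximalBifixCode F Y) where

            Completion-degree : HasDegree F Completion (suc e)
            Completion-degree with u , u∈F , full ← δ-unbounded ¬maximal (suc e) =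
              (u , u∈F , subst (ParseCount Completion u)
                (trans (δ-Completion u u∈F) (m≤n⇒m⊓n≡m full)) (δ-ParseCount Completion-bifix u)) ,
              δ≤⇒ParsesBoundedOn Completion-bifix
                (λ {w} w∈F → ≤-trans (≤-reflexive (δ-Completion w w∈F)) (m⊓n≤m (suc e) (δ Y w)))

            -- Place `y` in a word of `F` between two copies of a word `u` of large count. Extend
            -- `y` to the right until the count exceeds `e`, then to the left until it exceeds
            -- `suc e`; the result is overfull.
            Y⊆Kernel : Y ⊆ Kernel Completion
            Y⊆Kernel {y} y∈Y
              with u , u∈F , big ← δ-unbounded ¬maximal (suc (suc e))
              with t , _ , uty∈F ← recurrent u y u∈F (Y⊆F y∈Y)
              with t′ , _ , W∈F ← recurrent (u ++ t ++ y) u uty∈F u∈F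
              -- The threshold is `e` here and `suc e` on the left, so that at least one letter is
              -- added on each side.
              with s , b , (r₂ , t′u≡) , lo , hi ← δ-crossingʳ Y-bifix y (t′ ++ u) (bounded y∈Y)
                     (≤-trans (<⇒≤ big) (≤-trans (δ-++ˡ Y t′ u) (δ-++ˡ Y y (t′ ++ u))))
              with a , q , (r₁ , ut≡) , lo′ , hi′ ← δ-crossingˡ Y {suc e} (u ++ t) (y ++ s ∷ʳ b)
                     (subst (λ z → δ Y z ≤ suc e) (++-assoc y s [ b ]) (≤-trans (δ-∷ʳ-≤ Y-bifix (y ++ s) b) (s≤s lo)))
                     (≤-trans big (≤-trans (δ-factor Y-bifix [] u (t ++ y ++ s ∷ʳ b))
                       (≤-reflexive (cong (δ Y) (sym (++-assoc u t (y ++ s ∷ʳ b)))))))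
              = inj₁ y∈Y , a ∷ q , s ∷ʳ b , (λ ()) , (λ eq → case ++-conicalʳ s [ b ] eq of λ ()) ,
                inj₂ (overfull (suc e) a (q ++ y ++ s ∷ʳ b) (a ∷ q ++ y ++ s) b (cong (a ∷_) z≡)
                  (factorial r₁ _ r₂ (subst F W≡ W∈F)) hi′ lo′
                  -- Without a suffix in `Y`, deleting `b` lowers the count by exactly 1, from at
                  -- most `suc (suc e)`.
                  (s≤s⁻¹ (subst (_≤ suc (suc e))
                    (trans (cong (δ Y ∘ (a ∷_)) z≡) (δ-∷ʳ-unsuffixed Y-bifix (a ∷ q ++ y ++ s) b ¬suffixed))
                    (≤-trans (δ-∷-≤ Y a (q ++ y ++ s ∷ʳ b)) (s≤s lo′)))))
              where
              z≡ : q ++ y ++ s ∷ʳ b ≡ (q ++ y ++ s) ∷ʳ b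
              z≡ rewrite ++-assoc q (y ++ s) [ b ] | ++-assoc y s [ b ] = refl

              W≡ : (u ++ t ++ y) ++ t′ ++ u ≡ r₁ ++ ((a ∷ q) ++ y ++ s ∷ʳ b) ++ r₂
              W≡ rewrite sym (++-assoc u t y) | ut≡ | t′u≡
                       | ++-assoc (r₁ ++ a ∷ q) y ((s ∷ʳ b) ++ r₂)
                       | ++-assoc r₁ (a ∷ q) (y ++ (s ∷ʳ b) ++ r₂)
                       | ++-assoc q (y ++ s ∷ʳ b) r₂
                       | ++-assoc y (s ∷ʳ b) r₂
                = refl

              -- A suffix in `Y` inside `y ++ s ∷ʳ b` would prevent `b` from raising the count
              -- there. A longer one would contain `y ++ s ∷ʳ b` and so have more than `e` parses.
              ¬suffixed : ¬ Suffixed Y ((a ∷ q ++ y ++ s) ∷ʳ b)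
              ¬suffixed (x , (r , eq) , x∈Y) with levi (a ∷ q) r (trans (cong (a ∷_) z≡) eq)
              ... | inj₁ (r′ , _ , z≡r′x) = <⇒≱ hi (≤-trans (≤-reflexive (trans
                      (cong (δ Y) (sym (++-assoc y s [ b ])))
                      (δ-∷ʳ-suffixed Y-bifix (y ++ s) b (x , (r′ , trans (++-assoc y s [ b ]) z≡r′x) , x∈Y)))) lo)
              ... | inj₂ (r′ , _ , refl) = <⇒≱ hi (≤-trans (δ-++ˡ Y r′ (y ++ s ∷ʳ b)) (bounded x∈Y))

            Kernel⊆Y : Kernel Completion ⊆ Y
            Kernel⊆Y (inj₁ x∈Y , _) = x∈Y
            Kernel⊆Y {x} (inj₂ x∈G , p , s , p≢[] , _ , pxs∈X) =
              contradiction (proj₁ (Overfull-not-inner p x s x∈G pxs∈X refl)) p≢[]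

-- The excluded case is a genuine exception: if `F` contains only `[]`, the empty code has degree 1
-- and is its own kernel, yet it is also maximal.
mainTheorem8 : ExcludedMiddle 0ℓ →
    (A : Set) (k : ℕ) → A ↔ Fin k →
    (F : Language A) → Recurrent F →
    (d : ℕ) → 1 ≤ d →
    ¬ (F ≐ ｛ [] ｝ × d ≡ 1) →
    (Y : Language A) → BifixCode Y → Y ⊆ F →
    (∃[ X ] (BifixCode X × X ⊆ F × HasDegree F X d × Y ≐ Kernel X))
    ⇔
    (¬ MaximalBifixCode F Y × ParsesBoundedOn Y Y (d ∸ 1))
mainTheorem8 em A k _ F F-recurrent (suc e) 1≤d ¬trivial Y Y-bifix Y⊆F = mk⇔ necessary sufficient
  where
  open Classical em

  necessary : ∃[ X ] (BifixCode X × X ⊆ F × HasDegree F X (suc e) × Y ≐ Kernel X) →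
              ¬ MaximalBifixCode F Y × ParsesBoundedOn Y Y e
  necessary (X , X-bifix , X⊆F , X-degree , Y⊆K , K⊆Y) = ¬maximal , δ≤⇒ParsesBoundedOn Y-bifix
    (λ {y} y∈Y → s≤s⁻¹ (subst (_< suc e)
      (sym (kernel-δ F-recurrent X-bifix X⊆F X-degree K⊆Y (λ x∈Y → proj₁ (Y⊆K x∈Y)) y ([] , refl) (Y⊆K y∈Y)))
      (below (Y⊆K y∈Y))))
    where
    below : ∀ {y} → y ∈ Kernel X → δ X y < suc e
    below = kernel-δ< F-recurrent X-bifix X⊆F X-degree

    ¬maximal : ¬ MaximalBifixCode F Y
    ¬maximal Y-maximal = ¬trivial (proj₁ trivial , ≤-antisym (proj₂ trivial) 1≤d)
      where
      X⊆Y : X ⊆ Y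
      X⊆Y {x} x∈X with em {x ∈ Y}
      ... | yes x∈Y = x∈Y
      -- `X` would be a bifix code in `F` properly containing the maximal code `Y`.
      ... | no x∉Y  = ⊥-elim (MaximalBifixCode.maximal Y-maximal
        (X , X-bifix , X⊆F , (λ y∈Y → proj₁ (Y⊆K y∈Y)) , λ X⊆Y′ → x∉Y (X⊆Y′ x∈X)))

      trivial : F ≐ ｛ [] ｝ × suc e ≤ 1
      trivial = δX<d⇒trivial F-recurrent X-bifix X⊆F X-degree (λ x∈X → below (Y⊆K (X⊆Y x∈X)))

  sufficient : ¬ MaximalBifixCode F Y × ParsesBoundedOn Y Y e →
               ∃[ X ] (BifixCode X × X ⊆ F × HasDegree F X (suc e) × Y ≐ Kernel X)
  sufficient (¬maximal , bounded) =
    Completion F-recurrent Y-bifix Y⊆F e δ≤e ,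
    Completion-bifix F-recurrent Y-bifix Y⊆F e δ≤e ,
    Completion⊆F F-recurrent Y-bifix Y⊆F e δ≤e ,
    Completion-degree F-recurrent Y-bifix Y⊆F e δ≤e ¬maximal ,
    Y⊆Kernel F-recurrent Y-bifix Y⊆F e δ≤e ¬maximal ,
    Kernel⊆Y F-recurrent Y-bifix Y⊆F e δ≤e ¬maximal
    where
    δ≤e : ∀ {y} → y ∈ Y → δ Y y ≤ e
    δ≤e = ParsesBoundedOn⇒δ≤ Y-bifix bounded
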